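{- (1) In each of the following groups of consecutive patterns of length $4$, any two patterns in the same group are super-strongly Wilf equivalent: (i) $0102, 0112$; (ii) $0021, 0121$; (iii) $1002, 1012, 1102$; (iv) $0100, 0110$; (v) $2013, 2103$; (vi) $1200, 1210, 1220$; (vii) $0211, 0221$; (viii) $1000, 1110$; (ix) $1001, 1011, 1101$; (x) $2100, 2210$; (xi) $2001, 2011, 2101, 2201$; (xii) $2012, 2102$; (xiii) $2010, 2110, 2120$; (xiv) $3012, 3102$. (2) Conversely, if $p\neq p'$ are consecutive patterns of length $4$ that are Wilf equivalent, then $p$ and $p'$ belong to the same group among (i)--(xiv). In particular, the only generalized Wilf equivalences (of any of the three types) between distinct consecutive patterns of length 4 are those listed in (1).
   Context: An inversion sequence of length $n$ is an integer sequence $e=e_1e_2\dots e_n$ with $0\le e_i<i$ for all $i$; $\mathbf{I}_n$ denotes the set of these. A pattern of length $r$ is a sequence $p=p_1\dots p_r$ with $p_i\in\{0,\dots,r-1\}$ such that whenever a value $j>0$ appears in $p$, the value $j-1$ also appears. The reduction of an integer word $w$ is obtained by replacing every occurrence of the $i$-th smallest distinct value of $w$ by $i-1$, for all $i$. An inversion sequence $e$ has an occurrence of the consecutive pattern $p$ (of length $r$) in position $i$ if the reduction of $e_ie_{i+1}\dots e_{i+r-1}$ equals $p$; $\mathrm{Em}(p,e)$ is the set of such positions $i$; $e$ avoids $p$ if $\mathrm{Em}(p,e)=\emptyset$, and $\mathbf{I}_n(p)$ is the set of $e\in\mathbf{I}_n$ avoiding $p$. Two consecutive patterns $p,p'$ are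 Wilf equivalent if $|\mathbf{I}_n(p)|=|\mathbf{I}_n(p')|$ for all $n$; strongly Wilf equivalent if for all $n,m$ the number of $e\in\mathbf{I}_n$ with exactly $m$ occurrences of $p$ equals that for $p'$; super-strongly Wilf equivalent if $|\{e\in\mathbf{I}_n:\mathrm{Em}(p,e)=T\}|=|\{e\in\mathbf{I}_n:\mathrm{Em}(p',e)=T\}|$ for all $n$ and all $T\subseteq[n]$. Super-strong implies strong implies Wilf equivalence. -}

module Defs where

open import Data.Bool.Properties using () renaming (_≟_ to _≟ᵇ_)
open import Data.Fin.Base using (Fin; zero; suc; toℕ; fromℕ; inject₁)
open import Data.Fin.Properties using (toℕ-fromℕ; toℕ-inject₁)
open import Data.Fin.Relation.Unary.Top using (view; ‵fromℕ; ‵inject₁)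
open import Data.Fin.Subset using (Subset; ⊥; ∣_∣)
open import Data.List.Base as List using (List; []; _∷_)
open import Data.List.Membership.Propositional using () renaming (_∈_ to _∈ˡ_)
open import Data.List.Membership.Propositional.Properties
  using (∈-cartesianProductWith⁺; ∈-cartesianProductWith⁻; ∈-upTo⁺; ∈-upTo⁻)
import Data.List.Properties as List
open import Data.List.Relation.Unary.All using ([])
open import Data.List.Relation.Unary.Any using (Any; here)
open import Data.List.Relation.Unary.Unique.Propositional using (Unique; []; _∷_)
open import Data.List.Relation.Unary.Unique.Propositional.Properties
  using (cartesianProductWith⁺; upTo⁺)
open import Data.Nat.Base using (ℕ; zero; suc; _<_)
open import Data.Nat.Properties using (_≟_; _<?_)
open import Data.Product.Base using (_×_; _,_)
open import Data.Vec.Base as Vec using (Vec; []; _∷_; _∷ʳ_; lookup; toList; tabulate)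
open import Data.Vec.Membership.Propositional using (_∈_)
open import Data.Vec.Properties as Vec using (∷ʳ-injective)
open import Relation.Binary.PropositionalEquality using (_≡_; refl; subst₂)
open import Relation.Nullary.Decidable using (Dec; does)
open import Relation.Unary using (Decidable)

private
  variable
    n r : ℕ

-- Positions are counted from 0, so the bound eᵢ < i reads e i < i + 1.
IsInvSeq : Vec ℕ n → Set
IsInvSeq {n} e = (i : Fin n) → lookup e i < suc (toℕ i)

-- The set Iₙ, as a list; see ∈-invSeqs⁺, ∈-invSeqs⁻ and invSeqs-unique.
invSeqs : ∀ n → List (Vec ℕ n)
invSeqs zero    = [] ∷ []
invSeqs (suc n) = List.cartesianProductWith _∷ʳ_ (invSeqs n) (List.upTo (suc n))

IsPattern : Vec ℕ r → Set
IsPattern {r} p = (∀ i → lookup p i < r) × (∀ j → suc j ∈ p → j ∈ p)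

-- The i-th smallest distinct value of w is the one with exactly i - 1
-- distinct values of w below it.
rank : List ℕ → ℕ → ℕ
rank w x = List.length (List.deduplicate _≟_ (List.filter (_<? x) w))

reduction : List ℕ → List ℕ
reduction w = List.map (rank w) w

-- A window running past the end of e is truncated by `take`, so its reduction
-- is shorter than p and no occurrence is recorded there.
OccursAt : Vec ℕ r → Vec ℕ n → Fin n → Set
OccursAt {r} p e i =
  reduction (List.take r (List.drop (toℕ i) (toList e))) ≡ toList p

occursAt? : (p : Vec ℕ r) (e : Vec ℕ n) → Decidable (OccursAt p e)
occursAt? p e i = List.≡-dec _≟_ _ _

Em : Vec ℕ r → Vec ℕ n → Subset n
Em p e = tabulate λ i → does (occursAt? p e i)

Avoids : Vec ℕ r → Vec ℕ n → Set
Avoids p e = Em p e ≡ ⊥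

infix 4 _≟ˢ_
_≟ˢ_ : (S T : Subset n) → Dec (S ≡ T)
_≟ˢ_ = Vec.≡-dec _≟ᵇ_

-- The number of e in Iₙ satisfying P.
# : {P : Vec ℕ n → Set} → Decidable P → ℕ
# {n} P? = List.length (List.filter P? (invSeqs n))

avoids? : (p : Vec ℕ r) → Decidable (Avoids {n = n} p)
avoids? p e = Em p e ≟ˢ ⊥

Wilf : Vec ℕ r → Vec ℕ r → Set
Wilf p p′ = ∀ n → # {n} (avoids? p) ≡ # {n} (avoids? p′)

StrongWilf : Vec ℕ r → Vec ℕ r → Set
StrongWilf p p′ = ∀ n m →
  # {n} (λ e → ∣ Em p e ∣ ≟ m) ≡ # {n} (λ e → ∣ Em p′ e ∣ ≟ m)

SuperStrongWilf : Vec ℕ r → Vec ℕ r → Set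
SuperStrongWilf p p′ = ∀ n (T : Subset n) →
  # (λ e → Em p e ≟ˢ T) ≡ # (λ e → Em p′ e ≟ˢ T)

pat : ℕ → ℕ → ℕ → ℕ → Vec ℕ 4
pat a b c d = a ∷ b ∷ c ∷ d ∷ []

groups : List (List (Vec ℕ 4))
groups =
    (pat 0 1 0 2 ∷ pat 0 1 1 2 ∷ [])
  ∷ (pat 0 0 2 1 ∷ pat 0 1 2 1 ∷ [])
  ∷ (pat 1 0 0 2 ∷ pat 1 0 1 2 ∷ pat 1 1 0 2 ∷ [])
  ∷ (pat 0 1 0 0 ∷ pat 0 1 1 0 ∷ [])
  ∷ (pat 2 0 1 3 ∷ pat 2 1 0 3 ∷ [])
  ∷ (pat 1 2 0 0 ∷ pat 1 2 1 0 ∷ pat 1 2 2 0 ∷ [])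
  ∷ (pat 0 2 1 1 ∷ pat 0 2 2 1 ∷ [])
  ∷ (pat 1 0 0 0 ∷ pat 1 1 1 0 ∷ [])
  ∷ (pat 1 0 0 1 ∷ pat 1 0 1 1 ∷ pat 1 1 0 1 ∷ [])
  ∷ (pat 2 1 0 0 ∷ pat 2 2 1 0 ∷ [])
  ∷ (pat 2 0 0 1 ∷ pat 2 0 1 1 ∷ pat 2 1 0 1 ∷ pat 2 2 0 1 ∷ [])
  ∷ (pat 2 0 1 2 ∷ pat 2 1 0 2 ∷ [])
  ∷ (pat 2 0 1 0 ∷ pat 2 1 1 0 ∷ pat 2 1 2 0 ∷ [])
  ∷ (pat 3 0 1 2 ∷ pat 3 1 0 2 ∷ [])
  ∷ []

SameGroup : Vec ℕ 4 → Vec ℕ 4 → Set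
SameGroup p p′ = Any (λ g → p ∈ˡ g × p′ ∈ˡ g) groups

private
  lookup-∷ʳ-inject₁ : (xs : Vec ℕ n) (x : ℕ) (i : Fin n) →
                      lookup (xs ∷ʳ x) (inject₁ i) ≡ lookup xs i
  lookup-∷ʳ-inject₁ (_ ∷ _)  x zero    = refl
  lookup-∷ʳ-inject₁ (_ ∷ xs) x (suc i) = lookup-∷ʳ-inject₁ xs x i

  lookup-∷ʳ-fromℕ : (xs : Vec ℕ n) (x : ℕ) → lookup (xs ∷ʳ x) (fromℕ n) ≡ x
  lookup-∷ʳ-fromℕ []       x = refl
  lookup-∷ʳ-fromℕ (_ ∷ xs) x = lookup-∷ʳ-fromℕ xs x

  isInvSeq-∷ʳ⁺ : (xs : Vec ℕ n) (x : ℕ) →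
                 IsInvSeq xs → x < suc n → IsInvSeq (xs ∷ʳ x)
  isInvSeq-∷ʳ⁺ {n} xs x h x<1+n i with view i
  ... | ‵fromℕ rewrite lookup-∷ʳ-fromℕ xs x | toℕ-fromℕ n = x<1+n
  ... | ‵inject₁ j rewrite lookup-∷ʳ-inject₁ xs x j | toℕ-inject₁ j = h j

  isInvSeq-∷ʳ⁻ : (xs : Vec ℕ n) (x : ℕ) →
                 IsInvSeq (xs ∷ʳ x) → IsInvSeq xs × x < suc n
  isInvSeq-∷ʳ⁻ {n} xs x h =
      (λ i → subst₂ (λ a b → a < suc b)
               (lookup-∷ʳ-inject₁ xs x i) (toℕ-inject₁ i) (h (inject₁ i)))
    , subst₂ (λ a b → a < suc b)
        (lookup-∷ʳ-fromℕ xs x) (toℕ-fromℕ n) (h (fromℕ n))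

∈-invSeqs⁺ : {e : Vec ℕ n} → IsInvSeq e → e ∈ˡ invSeqs n
∈-invSeqs⁺ {zero}  {[]} h = here refl
∈-invSeqs⁺ {suc n} {e}  h with Vec.initLast e
... | xs , x , refl with isInvSeq-∷ʳ⁻ xs x h
... | hxs , x<1+n =
  ∈-cartesianProductWith⁺ _∷ʳ_ (∈-invSeqs⁺ hxs) (∈-upTo⁺ x<1+n)

∈-invSeqs⁻ : {e : Vec ℕ n} → e ∈ˡ invSeqs n → IsInvSeq e
∈-invSeqs⁻ {zero}  _ ()
∈-invSeqs⁻ {suc n} e∈
  with ∈-cartesianProductWith⁻ _∷ʳ_ (invSeqs n) (List.upTo (suc n)) e∈
... | xs , x , xs∈ , x∈ , refl =
  isInvSeq-∷ʳ⁺ xs x (∈-invSeqs⁻ xs∈) (∈-upTo⁻ x∈)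

invSeqs-unique : ∀ n → Unique (invSeqs n)
invSeqs-unique zero    = [] ∷ []
invSeqs-unique (suc n) =
  cartesianProductWith⁺ _∷ʳ_ (∷ʳ-injective _ _) (invSeqs-unique n) (upTo⁺ (suc n))

-- Two patterns of one group arise from each other by copying entries of a window
-- onto its two middle places, e.g. 1002 becomes 1012 by copying the first entry to
-- the third place. Fixing S, doing this at every position of S maps the inversion
-- sequences with S ⊆ Em(p,e) bijectively onto those with S ⊆ Em(p′,e): distinct
-- occurrences of p share at most one entry, hence do not interfere, except that
-- those of 0102, 0112, 2010, 2110, 2120 may share two; for these the positions of S
-- are processed from right to left and the inverse works from left to right.
-- Inclusion–exclusion turns ⊆ into equality. Conversely, the numbers of inversion
-- sequences of length 11 avoiding each of the 75 patterns, found by a recursion on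
-- the last three entries, differ between any two patterns that share no group.

module Submission where

open import Defs
open import Data.List.Membership.Propositional using (_∈_)
open import Data.List.Relation.Unary.All using (All)
open import Data.Nat.Base using (ℕ)
open import Data.Product.Base using (_×_)
open import Data.Vec.Base using (Vec)
open import Function.Bundles using (_⇔_)
open import Relation.Binary.PropositionalEquality using (_≢_)

open import Data.Bool.Base as Bool using (Bool; true; false; T; if_then_else_; f≤t; b≤b)
import Data.Bool.Properties as Bool
open import Data.Empty using (⊥; ⊥-elim)
open import Data.Fin.Base using (Fin; zero; suc; inject₁; toℕ)
open import Data.Fin.Patterns using (0F; 1F; 2F; 3F)
open import Data.Fin.Properties using (all?; any?; toℕ-injective)
import Data.Fin.Subset as Subset
open import Data.Fin.Subset using (Subset; ∣_∣)
open import Data.List.Base as List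
  using (List; []; _∷_; _++_; length; filter; deduplicate; upTo; cartesianProductWith)
open import Data.List.Membership.DecPropositional using () renaming (_∈?_ to member?)
open import Data.List.Membership.Propositional.Properties
open import Data.List.Membership.Propositional.Properties.WithK using (unique∧set⇒bag)
import Data.List.Properties as List
open import Data.List.Relation.Binary.BagAndSetEquality using (∼bag⇒↭)
open import Data.List.Relation.Binary.Permutation.Propositional using (_↭_)
open import Data.List.Relation.Binary.Permutation.Propositional.Properties using (↭-length; filter-↭)
open import Data.List.Relation.Binary.Subset.Propositional using (_⊆_)
open import Data.List.Relation.Unary.All as All using ([]; _∷_)
open import Data.List.Relation.Unary.Any as Any using (Any; here; there)
open import Data.List.Relation.Unary.Unique.DecPropositional.Properties using (deduplicate-!)
open import Data.List.Relation.Unary.Unique.Propositional using (Unique; []; _∷_)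
import Data.List.Relation.Unary.Unique.Propositional.Properties as Unique
open import Data.Nat.Base using (zero; suc; pred; _+_; _≤_; _<_; _<ᵇ_; z≤n; s≤s)
open import Data.Nat.ListAction using (sum)
open import Data.Nat.Properties
open import Data.Product.Base using (_,_; proj₁; proj₂; ∃)
open import Data.Sum.Base using (_⊎_; inj₁; inj₂; [_,_]′)
open import Data.Unit.Base using (⊤; tt)
open import Data.Vec.Base as Vec using ([]; _∷_; lookup; toList)
import Data.Vec.Membership.Propositional as Vec
import Data.Vec.Membership.Propositional.Properties as Vec
import Data.Vec.Properties as Vec
open import Data.Vec.Relation.Binary.Pointwise.Inductive as Pointwise using (Pointwise; []; _∷_)
import Data.Vec.Relation.Unary.Any as VecAny
open import Function.Base using (_∘_; id)
open import Function.Bundles using (mk⇔; Equivalence)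
open import Relation.Binary.Definitions using (tri<; tri≈; tri>)
open import Relation.Binary.PropositionalEquality
  using (_≡_; refl; sym; trans; cong; cong₂; subst; subst₂; module ≡-Reasoning)
open import Relation.Nullary.Decidable
  using (Dec; yes; no; does; map′; _×-dec_; _⊎-dec_; _→-dec_; ¬?; True; toWitness; from-yes;
         does-⇔; dec-true; dec-false)
open import Relation.Nullary.Negation using (¬_)
open import Relation.Unary using (Decidable)

open Equivalence using (to; from)

private
  variable
    k n : ℕ

-- Reduction and relative order.

filter-map : {A B : Set} {P : B → Set} (P? : Decidable P) (f : A → B) (xs : List A) →
             filter P? (List.map f xs) ≡ List.map f (filter (P? ∘ f) xs)
filter-map P? f [] = refl
filter-map P? f (x ∷ xs) with does (P? (f x))
... | true  = cong (f x ∷_) (filter-map P? f xs)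
... | false = filter-map P? f xs

unique-⊆⇒length≤ : {xs ys : List ℕ} → Unique xs → xs ⊆ ys → length xs ≤ length ys
unique-⊆⇒length≤ {[]} _ _ = z≤n
unique-⊆⇒length≤ {x ∷ xs} {ys} (x∉xs ∷ xs!) xs⊆ys = ≤-trans
  (s≤s (unique-⊆⇒length≤ xs! λ y∈xs →
    ∈-filter⁺ (¬? ∘ (x ≟_)) (xs⊆ys (there y∈xs)) (All.lookup x∉xs y∈xs)))
  (List.filter-notAll (¬? ∘ (x ≟_)) ys (Any.map (λ x≡y x≢y → x≢y x≡y) (xs⊆ys (here refl))))

below : List ℕ → ℕ → List ℕ
below w x = deduplicate _≟_ (filter (_<? x) w)

below-∈⁺ : ∀ w {x y} → y ∈ w → y < x → y ∈ below w x
below-∈⁺ w y∈w y<x = ∈-deduplicate⁺ _≟_ (∈-filter⁺ (_<? _) y∈w y<x)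

below-∈⁻ : ∀ w {x y} → y ∈ below w x → y ∈ w × y < x
below-∈⁻ w {x} = ∈-filter⁻ (_<? x) ∘ ∈-deduplicate⁻ _≟_ (filter (_<? x) w)

-- `x` itself is a value below `y` but not below `x`, so `x ∷ below w x` is a duplicate-free list of
-- values of `w` below `y`.
rank-mono-< : ∀ w {x y} → x ∈ w → x < y → rank w x < rank w y
rank-mono-< w {x} {y} x∈w x<y = unique-⊆⇒length≤
  (All.tabulate (λ z∈ x≡z → <-irrefl (sym x≡z) (proj₂ (below-∈⁻ w z∈))) ∷ deduplicate-! _≟_ _)
  λ { (here refl) → below-∈⁺ w x∈w x<y
    ; (there z∈)  → let z∈w , z<x = below-∈⁻ w z∈ in below-∈⁺ w z∈w (<-trans z<x x<y) }

rank-cancel-< : ∀ w {x y} → y ∈ w → rank w x < rank w y → x < y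
rank-cancel-< w {x} {y} y∈w rx<ry with <-cmp x y
... | tri< x<y _ _   = x<y
... | tri≈ _ refl _  = ⊥-elim (<-irrefl refl rx<ry)
... | tri> _ _ y<x   = ⊥-elim (<-asym rx<ry (rank-mono-< w y∈w y<x))

OrderIso : {I : Set} → (I → ℕ) → (I → ℕ) → Set
OrderIso u v = ∀ i j → u i < u j ⇔ v i < v j

orderIso-sym : {I : Set} {u v : I → ℕ} → OrderIso u v → OrderIso v u
orderIso-sym iso i j = mk⇔ (from (iso i j)) (to (iso i j))

orderIso-≡ : {I : Set} {u v : I → ℕ} → OrderIso u v → ∀ {i j} → v i ≡ v j → u i ≡ u j
orderIso-≡ {u = u} iso {i} {j} vi≡vj with <-cmp (u i) (u j)
... | tri< u< _ _ = ⊥-elim (<-irrefl vi≡vj (to (iso i j) u<))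
... | tri≈ _ u≡ _ = u≡
... | tri> _ _ u> = ⊥-elim (<-irrefl (sym vi≡vj) (to (iso j i) u>))

orderIso-≤ : {I : Set} {u v : I → ℕ} → OrderIso u v → ∀ {i j} → v i ≤ v j → u i ≤ u j
orderIso-≤ iso {i} {j} vi≤vj = ≮⇒≥ (≤⇒≯ vi≤vj ∘ to (iso j i))

module _ {I : Set} {u v : I → ℕ} (iso : OrderIso u v) where
  -- Both deduplications keep the same indices, because an order isomorphism preserves and reflects
  -- equality as well.
  deduplicate-orderIso : ∀ is → ∃ λ js →
    deduplicate _≟_ (List.map u is) ≡ List.map u js × deduplicate _≟_ (List.map v is) ≡ List.map v js
  deduplicate-orderIso [] = [] , refl , refl
  deduplicate-orderIso (i ∷ is) with deduplicate-orderIso is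
  ... | js , equ , eqv = i ∷ filter (λ j → ¬? (u i ≟ u j)) js
    , cong (u i ∷_) (trans (cong (filter _) equ) (filter-map _ u js))
    , cong (v i ∷_) (trans (trans (cong (filter _) eqv) (filter-map _ v js))
        (cong (List.map v) (List.filter-≐ _ _
          ( (λ v≢ → v≢ ∘ orderIso-≡ (orderIso-sym iso))
          , (λ u≢ → u≢ ∘ orderIso-≡ iso)) js)))

  rank-orderIso : ∀ is i → rank (List.map u is) (u i) ≡ rank (List.map v is) (v i)
  rank-orderIso is i
    rewrite filter-map (_<? u i) u is | filter-map (_<? v i) v is
          | List.filter-≐ (λ j → v j <? v i) (λ j → u j <? u i)
              ((λ {j} → from (iso j i)) , (λ {j} → to (iso j i))) is
    with deduplicate-orderIso (filter (λ j → u j <? u i) is)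
  ... | js , equ , eqv = begin
    length (deduplicate _≟_ (List.map u ks)) ≡⟨ cong length equ ⟩
    length (List.map u js)                   ≡⟨ List.length-map u js ⟩
    length js                                ≡⟨ List.length-map v js ⟨
    length (List.map v js)                   ≡⟨ cong length eqv ⟨
    length (deduplicate _≟_ (List.map v ks)) ∎
    where
    open ≡-Reasoning
    ks = filter (λ j → u j <? u i) is

  reduction-orderIso : ∀ is → reduction (List.map u is) ≡ reduction (List.map v is)
  reduction-orderIso is = begin
    List.map (rank us) (List.map u is) ≡⟨ List.map-∘ is ⟨
    List.map (rank us ∘ u) is          ≡⟨ List.map-cong (rank-orderIso is) is ⟩
    List.map (rank vs ∘ v) is          ≡⟨ List.map-∘ is ⟩
    List.map (rank vs) (List.map v is) ∎
    where
    open ≡-Reasoning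
    us = List.map u is
    vs = List.map v is

-- A record, so that `w` and `p` can be inferred: `OrderIso` unfolds to a function type from which
-- they cannot be read off.
record Iso {r} (w p : Vec ℕ r) : Set where
  constructor mkIso
  field
    orderIso : OrderIso (lookup w) (lookup p)

open Iso

toList≡map : ∀ {r} (w : Vec ℕ r) → toList w ≡ List.map (lookup w) (List.allFin r)
toList≡map [] = refl
toList≡map (x ∷ w) = cong (x ∷_) (trans (toList≡map w)
  (trans (List.map-tabulate id (lookup w)) (sym (List.map-tabulate suc (lookup (x ∷ w))))))

iso⇒reduction : ∀ {r} {w p : Vec ℕ r} → Iso w p → reduction (toList w) ≡ reduction (toList p)
iso⇒reduction {w = w} {p} w≅p rewrite toList≡map w | toList≡map p = reduction-orderIso (orderIso w≅p) _

∈-toList : ∀ {r} (w : Vec ℕ r) i → lookup w i ∈ toList w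
∈-toList w i = subst (lookup w i ∈_) (sym (toList≡map w)) (∈-map⁺ (lookup w) (∈-allFin i))

map-lookup-≡ : {I : Set} {u v : I → ℕ} {is : List I} → List.map u is ≡ List.map v is →
               ∀ {i} → i ∈ is → u i ≡ v i
map-lookup-≡ {is = _ ∷ _} eq (here refl) = List.∷-injectiveˡ eq
map-lookup-≡ {is = _ ∷ _} eq (there i∈)  = map-lookup-≡ (List.∷-injectiveʳ eq) i∈

-- `rank (toList w)` preserves and reflects the order of the entries of `w`, and by hypothesis it
-- sends them to the entries of `p`.
reduction≡⇒iso : ∀ {r} {w p : Vec ℕ r} → reduction (toList w) ≡ toList p → Iso w p
reduction≡⇒iso {r} {w} {p} eq = mkIso λ i j →
  mk⇔ (λ w< → subst₂ _<_ (rank≡ i) (rank≡ j) (rank-mono-< (toList w) (∈-toList w i) w<))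
      (λ p< → rank-cancel-< (toList w) (∈-toList w j) (subst₂ _<_ (sym (rank≡ i)) (sym (rank≡ j)) p<))
  where
  rank≡ : ∀ k → rank (toList w) (lookup w k) ≡ lookup p k
  rank≡ k = map-lookup-≡ {u = rank (toList w) ∘ lookup w} (begin
    List.map (rank (toList w) ∘ lookup w) (List.allFin r)
      ≡⟨ List.map-∘ _ ⟩
    List.map (rank (toList w)) (List.map (lookup w) (List.allFin r))
      ≡⟨ cong (List.map (rank (toList w))) (toList≡map w) ⟨
    reduction (toList w)
      ≡⟨ eq ⟩
    toList p
      ≡⟨ toList≡map p ⟩
    List.map (lookup p) (List.allFin r) ∎) (∈-allFin k)
    where open ≡-Reasoning

-- Counting by bijections.

unique-⇔⇒↭ : {A : Set} {xs ys : List A} → Unique xs → Unique ys →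
             (∀ {x} → x ∈ xs ⇔ x ∈ ys) → xs ↭ ys
unique-⇔⇒↭ xs! ys! eq = ∼bag⇒↭ (unique∧set⇒bag xs! ys! eq)

count : {A : Set} {P : A → Set} → Decidable P → List A → ℕ
count P? xs = length (filter P? xs)

module _ {A : Set} {P Q : A → Set} (P? : Decidable P) (Q? : Decidable Q) where
  count-≐ : (∀ x → P x ⇔ Q x) → ∀ xs → count P? xs ≡ count Q? xs
  count-≐ P⇔Q xs = cong length (List.filter-≐ P? Q? ((λ {x} → to (P⇔Q x)) , (λ {x} → from (P⇔Q x))) xs)

  -- Since `g` inverts `f` where `P` holds, the list of images is duplicate-free; it has the same
  -- members as `filter Q? xs` and hence is a permutation of it.
  count-bijection : ∀ {xs} (f g : A → A) → Unique xs →
    (∀ {x} → x ∈ xs → P x → f x ∈ xs × Q (f x) × g (f x) ≡ x) →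
    (∀ {x} → x ∈ xs → Q x → g x ∈ xs × P (g x) × f (g x) ≡ x) →
    count P? xs ≡ count Q? xs
  count-bijection {xs} f g xs! fP gQ = begin
    length ps               ≡⟨ List.length-map f ps ⟨
    length (List.map f ps)  ≡⟨ ↭-length (unique-⇔⇒↭ fps! (Unique.filter⁺ Q? xs!) (mk⇔ ⇒ ⇐)) ⟩
    length (filter Q? xs)   ∎
    where
    open ≡-Reasoning
    ps = filter P? xs

    gf : List.map g (List.map f ps) ≡ ps
    gf = trans (sym (List.map-∘ ps)) (List.map-id-local
      (All.tabulate λ x∈ → let x∈xs , Px = ∈-filter⁻ P? x∈ in proj₂ (proj₂ (fP x∈xs Px))))

    fps! : Unique (List.map f ps)
    fps! = Unique.map⁻ (subst Unique (sym gf) (Unique.filter⁺ P? xs!))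

    ⇒ : ∀ {y} → y ∈ List.map f ps → y ∈ filter Q? xs
    ⇒ y∈ with ∈-map⁻ f y∈
    ... | x , x∈ , refl = let x∈xs , Px = ∈-filter⁻ P? x∈
                              fx∈ , Qfx , _ = fP x∈xs Px in ∈-filter⁺ Q? fx∈ Qfx

    ⇐ : ∀ {y} → y ∈ filter Q? xs → y ∈ List.map f ps
    ⇐ y∈ = let y∈xs , Qy = ∈-filter⁻ Q? y∈
               gy∈ , Pgy , fgy = gQ y∈xs Qy
           in subst (_∈ _) fgy (∈-map⁺ f (∈-filter⁺ P? gy∈ Pgy))

count-map : {A B : Set} {P : B → Set} (P? : Decidable P) (f : A → B) (xs : List A) →
            count P? (List.map f xs) ≡ count (P? ∘ f) xs
count-map P? f xs = trans (cong length (filter-map P? f xs)) (List.length-map f (filter (P? ∘ f) xs))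

-- From containment of sets of positions to arbitrary properties.

infix 4 _⊑_ _⊑?_

_⊑_ : Subset n → Subset n → Set
_⊑_ = Pointwise Bool._≤_

_⊑?_ : (S : Subset n) → Decidable (S ⊑_)
S ⊑? T = Pointwise.decidable Bool._≤?_ S T

tailsWith : Bool → List (Subset (suc n)) → List (Subset n)
tailsWith b [] = []
tailsWith true  ((true  ∷ S) ∷ Ss) = S ∷ tailsWith true Ss
tailsWith true  ((false ∷ S) ∷ Ss) = tailsWith true Ss
tailsWith false ((true  ∷ S) ∷ Ss) = tailsWith false Ss
tailsWith false ((false ∷ S) ∷ Ss) = S ∷ tailsWith false Ss

count-tailsWith : ∀ {P : Subset (suc n) → Set} (P? : Decidable P) Ss →
  count P? Ss ≡ count (P? ∘ (true ∷_)) (tailsWith true Ss) + count (P? ∘ (false ∷_)) (tailsWith false Ss)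
count-tailsWith P? [] = refl
count-tailsWith P? ((true ∷ S) ∷ Ss) with does (P? (true ∷ S))
... | true  = cong suc (count-tailsWith P? Ss)
... | false = count-tailsWith P? Ss
count-tailsWith P? ((false ∷ S) ∷ Ss) with does (P? (false ∷ S))
... | true  = trans (cong suc (count-tailsWith P? Ss)) (sym (+-suc _ _))
... | false = count-tailsWith P? Ss

count-true∷⊑ : ∀ (S : Subset n) Ss →
  count ((true ∷ S) ⊑?_) Ss ≡ count (S ⊑?_) (tailsWith true Ss)
count-true∷⊑ S Ss = begin
  count ((true ∷ S) ⊑?_) Ss
    ≡⟨ count-tailsWith ((true ∷ S) ⊑?_) Ss ⟩
  count (λ T → (true ∷ S) ⊑? (true ∷ T)) (tailsWith true Ss) +
  count (λ T → (true ∷ S) ⊑? (false ∷ T)) (tailsWith false Ss)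
    ≡⟨ cong₂ _+_ (count-≐ _ (S ⊑?_) (λ T → mk⇔ Pointwise.tail (b≤b ∷_)) (tailsWith true Ss))
         (cong length (List.filter-none (λ T → (true ∷ S) ⊑? (false ∷ T))
           (All.universal (λ { _ (() ∷ _) }) (tailsWith false Ss)))) ⟩
  count (S ⊑?_) (tailsWith true Ss) + 0
    ≡⟨ +-identityʳ _ ⟩
  count (S ⊑?_) (tailsWith true Ss) ∎
  where open ≡-Reasoning

-- The first position is unconstrained, so the counts over both tails add up. Subtracting
-- `count-true∷⊑` isolates the sets without the first position.
count-false∷⊑ : ∀ (S : Subset n) Ss → count ((false ∷ S) ⊑?_) Ss ≡
  count (S ⊑?_) (tailsWith true Ss) + count (S ⊑?_) (tailsWith false Ss)
count-false∷⊑ S Ss = trans (count-tailsWith ((false ∷ S) ⊑?_) Ss) (cong₂ _+_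
  (count-≐ _ (S ⊑?_) (λ T → mk⇔ Pointwise.tail (f≤t ∷_)) (tailsWith true Ss))
  (count-≐ _ (S ⊑?_) (λ T → mk⇔ Pointwise.tail (b≤b ∷_)) (tailsWith false Ss)))

-- Inclusion–exclusion.
count-⊑⇒count : ∀ (Ss Ts : List (Subset n)) →
  (∀ S → count (S ⊑?_) Ss ≡ count (S ⊑?_) Ts) →
  {P : Subset n → Set} (P? : Decidable P) → count P? Ss ≡ count P? Ts
count-⊑⇒count {zero} Ss Ts eq P? with P? []
... | yes P[] = begin
    count P? Ss       ≡⟨ count-≐ P? ([] ⊑?_) iff Ss ⟩
    count ([] ⊑?_) Ss ≡⟨ eq [] ⟩
    count ([] ⊑?_) Ts ≡⟨ count-≐ P? ([] ⊑?_) iff Ts ⟨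
    count P? Ts       ∎
    where
    open ≡-Reasoning
    iff : ∀ S → _ ⇔ ([] ⊑ S)
    iff [] = mk⇔ (λ _ → []) (λ _ → P[])
... | no ¬P[] = trans (none Ss) (sym (none Ts))
    where
    none : ∀ Ss → count P? Ss ≡ 0
    none Ss = cong length (List.filter-none P? (All.universal (λ { [] → ¬P[] }) Ss))
count-⊑⇒count {suc n} Ss Ts eq P? = begin
  count P? Ss ≡⟨ count-tailsWith P? Ss ⟩
  _           ≡⟨ cong₂ _+_ (count-⊑⇒count (tailsWith true Ss) (tailsWith true Ts) eq-true (P? ∘ (true ∷_)))
                           (count-⊑⇒count (tailsWith false Ss) (tailsWith false Ts) eq-false (P? ∘ (false ∷_))) ⟩
  _           ≡⟨ count-tailsWith P? Ts ⟨
  count P? Ts ∎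
  where
  open ≡-Reasoning
  eq-true : ∀ S → count (S ⊑?_) (tailsWith true Ss) ≡ count (S ⊑?_) (tailsWith true Ts)
  eq-true S = trans (sym (count-true∷⊑ S Ss)) (trans (eq (true ∷ S)) (count-true∷⊑ S Ts))

  eq-false : ∀ S → count (S ⊑?_) (tailsWith false Ss) ≡ count (S ⊑?_) (tailsWith false Ts)
  eq-false S = +-cancelˡ-≡ (count (S ⊑?_) (tailsWith true Ss)) _ _ (begin
    _ ≡⟨ count-false∷⊑ S Ss ⟨
    _ ≡⟨ eq (false ∷ S) ⟩
    _ ≡⟨ count-false∷⊑ S Ts ⟩
    _ ≡⟨ cong (_+ count (S ⊑?_) (tailsWith false Ts)) (eq-true S) ⟨
    _ ∎)

-- Occurrences and the inversion bound along a word.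

Occ : Vec ℕ 4 → Vec ℕ n → Set
Occ p []                  = ⊥
Occ p (_ ∷ [])            = ⊥
Occ p (_ ∷ _ ∷ [])        = ⊥
Occ p (_ ∷ _ ∷ _ ∷ [])    = ⊥
Occ p (a ∷ b ∷ c ∷ d ∷ _) = Iso (a ∷ b ∷ c ∷ d ∷ []) p

-- `OccursAt` compares a reduction with `p` itself, `Occ` only relative orders; the two agree when
-- `p` is its own reduction.
Reduced : Vec ℕ 4 → Set
Reduced p = reduction (toList p) ≡ toList p

occursAt-zero : ∀ {p} → Reduced p → (e : Vec ℕ (suc n)) → OccursAt p e zero ⇔ Occ p e
occursAt-zero {p = _ ∷ _ ∷ _ ∷ _ ∷ []} p-red (_ ∷ [])         = mk⇔ (λ ()) λ ()
occursAt-zero {p = _ ∷ _ ∷ _ ∷ _ ∷ []} p-red (_ ∷ _ ∷ [])     = mk⇔ (λ ()) λ ()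
occursAt-zero {p = _ ∷ _ ∷ _ ∷ _ ∷ []} p-red (_ ∷ _ ∷ _ ∷ []) = mk⇔ (λ ()) λ ()
occursAt-zero {p = p} p-red (a ∷ b ∷ c ∷ d ∷ _) =
  mk⇔ reduction≡⇒iso
      (λ iso → trans (iso⇒reduction iso) p-red)

OccAll : Vec ℕ 4 → Subset n → Vec ℕ n → Set
OccAll p []      []       = ⊤
OccAll p (s ∷ S) (x ∷ xs) = (T s → Occ p (x ∷ xs)) × OccAll p S xs

⊑Em⇔OccAll : ∀ {p} → Reduced p → (S : Subset n) (e : Vec ℕ n) → S ⊑ Em p e ⇔ OccAll p S e
⊑Em⇔OccAll p-red [] [] = mk⇔ (λ _ → tt) (λ _ → [])
⊑Em⇔OccAll {p = p} p-red (s ∷ S) e@(_ ∷ xs) = mk⇔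
  (λ { (s≤ ∷ S⊑) → head⇒ s≤ , to (⊑Em⇔OccAll p-red S xs) S⊑ })
  (λ { (occ , all) → head⇐ s occ ∷ from (⊑Em⇔OccAll p-red S xs) all })
  where
  head⇒ : ∀ {s} → s Bool.≤ does (occursAt? p e zero) → T s → Occ p e
  head⇒ s≤ Ts with occursAt? p e zero
  head⇒ s≤  Ts | yes occ = to (occursAt-zero p-red e) occ
  head⇒ b≤b () | no _

  head⇐ : ∀ s → (T s → Occ p e) → s Bool.≤ does (occursAt? p e zero)
  head⇐ true  occ = Bool.≤-reflexive (sym
    (dec-true (occursAt? p e zero) (from (occursAt-zero p-red e) (occ tt))))
  head⇐ false _   = Bool.≤-minimum _

-- The condition on inversion sequences for a suffix preceded by `k` entries.
Bounded : ℕ → Vec ℕ n → Set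
Bounded k []       = ⊤
Bounded k (x ∷ xs) = x ≤ k × Bounded (suc k) xs

bounded⇔ : ∀ k (e : Vec ℕ n) → Bounded k e ⇔ (∀ i → lookup e i ≤ k + toℕ i)
bounded⇔ k [] = mk⇔ (λ _ ()) (λ _ → tt)
bounded⇔ k (x ∷ xs) = mk⇔
  (λ { (x≤k , _) zero → ≤-trans x≤k (m≤m+n k 0)
     ; (_ , bd) (suc i) → ≤-trans (to (bounded⇔ (suc k) xs) bd i) (≤-reflexive (sym (+-suc k _))) })
  (λ bd → ≤-trans (bd zero) (≤-reflexive (+-identityʳ k))
     , from (bounded⇔ (suc k) xs) λ i → ≤-trans (bd (suc i)) (≤-reflexive (+-suc k _)))

isInvSeq⇔bounded : (e : Vec ℕ n) → IsInvSeq e ⇔ Bounded 0 e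
isInvSeq⇔bounded e = mk⇔ (λ inv → from (bounded⇔ 0 e) (λ i → ≤-pred (inv i)))
                         (λ bd i → s≤s (to (bounded⇔ 0 e) bd i))

-- Rewiring a window.

-- (i , j) stands for the map 0 ↦ 0, 1 ↦ i, 2 ↦ j, 3 ↦ 3 of the places of a window.
Rewiring : Set
Rewiring = Fin 4 × Fin 4

rewire : Rewiring → Vec ℕ 4 → Vec ℕ 4
rewire (i , j) w = Vec.map (lookup w) (0F ∷ i ∷ j ∷ 3F ∷ [])

iso-rewire : ∀ σ {w p} → Iso w p → Iso (rewire σ w) (rewire σ p)
iso-rewire (i , j) {w} {p} iso = mkIso order
  where
  κ = 0F ∷ i ∷ j ∷ 3F ∷ []

  order : OrderIso (lookup (rewire (i , j) w)) (lookup (rewire (i , j) p))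
  order k l
    rewrite Vec.lookup-map k (lookup w) κ | Vec.lookup-map l (lookup w) κ
          | Vec.lookup-map k (lookup p) κ | Vec.lookup-map l (lookup p) κ
    = orderIso iso _ _

-- That a place of `p` is restored says that two entries of `p` are equal; the corresponding entries
-- of `w` are then equal too.
rewire² : ∀ σ τ {w p} → Iso w p → rewire τ (rewire σ p) ≡ p → rewire τ (rewire σ w) ≡ w
rewire² (i , j) (k , l) {w = a ∷ b ∷ c ∷ d ∷ []} {p = _ ∷ _ ∷ _ ∷ _ ∷ []} iso eq =
  cong₂ (λ x y → a ∷ x ∷ y ∷ d ∷ [])
    (back k 1F (Vec.∷-injectiveˡ (Vec.∷-injectiveʳ eq)))
    (back l 2F (Vec.∷-injectiveˡ (Vec.∷-injectiveʳ (Vec.∷-injectiveʳ eq))))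
  where
  w = a ∷ b ∷ c ∷ d ∷ []
  p = _ ∷ _ ∷ _ ∷ _ ∷ []
  κ = 0F ∷ i ∷ j ∷ 3F ∷ []

  back : ∀ k m → lookup (Vec.map (lookup p) κ) k ≡ lookup p m →
         lookup (Vec.map (lookup w) κ) k ≡ lookup w m
  back k m eq = trans (Vec.lookup-map k (lookup w) κ)
    (orderIso-≡ (orderIso iso) {lookup κ k} {m} (trans (sym (Vec.lookup-map k (lookup p) κ)) eq))

-- An entry dominated in this sense may be copied to place m of the window: the
-- result still satisfies the upper bound imposed on an inversion sequence there.
Dominated : Vec ℕ 4 → Fin 4 → ℕ → Set
Dominated p i m = ∃ λ j →
  (toℕ j ≤ m × lookup p i ≤ lookup p j) ⊎ (toℕ j ≤ suc m × lookup p i < lookup p j)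

dominated? : ∀ p i m → Dec (Dominated p i m)
dominated? p i m = any? λ j →
  (toℕ j ≤? m ×-dec lookup p i ≤? lookup p j) ⊎-dec (toℕ j ≤? suc m ×-dec lookup p i <? lookup p j)

-- In the strict case the entry is at least one less than an entry at place at most `m + 1`, whose
-- own bound is at most `k + m + 1`.
dominated-≤ : ∀ {p w i m k} → Iso w p → Dominated p i m → Bounded k w → lookup w i ≤ k + m
dominated-≤ {w = w} {i = i} {m} {k} iso (j , inj₁ (j≤m , pi≤pj)) bd = begin
  lookup w i ≤⟨ orderIso-≤ (orderIso iso) {i} {j} pi≤pj ⟩
  lookup w j ≤⟨ to (bounded⇔ k w) bd j ⟩
  k + toℕ j  ≤⟨ +-monoʳ-≤ k j≤m ⟩
  k + m      ∎
  where open ≤-Reasoning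
dominated-≤ {w = w} {i = i} {m} {k} iso (j , inj₂ (j≤1+m , pi<pj)) bd = ≤-pred (begin
  suc (lookup w i) ≤⟨ from (orderIso iso i j) pi<pj ⟩
  lookup w j       ≤⟨ to (bounded⇔ k w) bd j ⟩
  k + toℕ j        ≤⟨ +-monoʳ-≤ k j≤1+m ⟩
  k + suc m        ≡⟨ +-suc k m ⟩
  suc (k + m)      ∎)
  where open ≤-Reasoning

-- Rewirings fix the first place, so the first entry `a` of the window is an argument and only the
-- rest of the word is returned. Words too short to hold a window stay as they are by default.
rewireAfter : Rewiring → ℕ → Vec ℕ n → Vec ℕ n
rewireAfter σ a []           = []
rewireAfter σ a (b ∷ [])     = b ∷ []
rewireAfter σ a (b ∷ c ∷ []) = b ∷ c ∷ []
rewireAfter (i , j) a (b ∷ c ∷ d ∷ xs) =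
  lookup (a ∷ b ∷ c ∷ d ∷ []) i ∷ lookup (a ∷ b ∷ c ∷ d ∷ []) j ∷ d ∷ xs

step : Rewiring → Bool → ℕ → Vec ℕ n → Vec ℕ n
step σ s x xs = if s then rewireAfter σ x xs else xs

-- The recursive call precedes the step, so the rightmost position is treated first.
-- `rewireRightward` steps before it recurses.
rewireLeftward : Rewiring → Subset n → Vec ℕ n → Vec ℕ n
rewireLeftward σ []      []       = []
rewireLeftward σ (s ∷ S) (x ∷ xs) = x ∷ step σ s x (rewireLeftward σ S xs)

rewireRightward : Rewiring → Subset n → Vec ℕ n → Vec ℕ n
rewireRightward τ []      []       = []
rewireRightward τ (s ∷ S) (x ∷ xs) = x ∷ rewireRightward τ S (step τ s x xs)

-- Decided through the Boolean `_<ᵇ_`, since it is evaluated for very many windows in the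
-- enumeration below.
<-⇔-<? : ∀ x y u v → Dec (x < y ⇔ u < v)
<-⇔-<? x y u v = map′
  (λ eq → mk⇔ (<ᵇ⇒< u v ∘ subst T eq ∘ <⇒<ᵇ) (<ᵇ⇒< x y ∘ subst T (sym eq) ∘ <⇒<ᵇ))
  (λ iff → does-⇔ iff (x <? y) (u <? v))
  ((x <ᵇ y) Bool.≟ (u <ᵇ v))

-- A necessary condition for two occurrences of `p` to overlap so that places `f` of one window are
-- places `g` of the other.
OverlapBy : ∀ {m} → (Fin m → Fin 4) → (Fin m → Fin 4) → Vec ℕ 4 → Set
OverlapBy f g p = OrderIso (lookup p ∘ f) (lookup p ∘ g)

overlapBy? : ∀ {m} (f g : Fin m → Fin 4) p → Dec (OverlapBy f g p)
overlapBy? f g p = all? λ i → all? λ j → <-⇔-<? _ _ _ _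

iso²⇒overlapBy : ∀ {m} {f g : Fin m → Fin 4} {p v w} → (∀ i → lookup v (f i) ≡ lookup w (g i)) →
                 Iso v p → Iso w p → OverlapBy f g p
iso²⇒overlapBy eq v≅p w≅p i j = mk⇔
  (λ p< → to (orderIso w≅p _ _) (subst₂ _<_ (eq i) (eq j) (from (orderIso v≅p _ _) p<)))
  (λ p< → to (orderIso v≅p _ _) (subst₂ _<_ (sym (eq i)) (sym (eq j)) (from (orderIso w≅p _ _) p<)))

OverlapBy3 OverlapBy2 : Vec ℕ 4 → Set
OverlapBy3 = OverlapBy suc inject₁
OverlapBy2 = OverlapBy {2} (λ i → suc (suc i)) (λ i → inject₁ (inject₁ i))

overlapBy3 : ∀ {p a b c d e} → Iso (a ∷ b ∷ c ∷ d ∷ []) p → Iso (b ∷ c ∷ d ∷ e ∷ []) p → OverlapBy3 p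
overlapBy3 = iso²⇒overlapBy λ { 0F → refl ; 1F → refl ; 2F → refl }

overlapBy2 : ∀ {p a b c d e f} → Iso (a ∷ b ∷ c ∷ d ∷ []) p → Iso (c ∷ d ∷ e ∷ f ∷ []) p → OverlapBy2 p
overlapBy2 = iso²⇒overlapBy {f = λ i → suc (suc i)} {λ i → inject₁ (inject₁ i)}
  λ { 0F → refl ; 1F → refl }

-- Rewiring two occurrences at distance two, the right one first for σ and
-- the left one first for τ, keeps an occurrence at either place.
ChainsLeftward : Rewiring → Vec ℕ 4 → Vec ℕ 4 → Set
ChainsLeftward (i , j) p p′ = ∀ {a b c d e f} →
  Iso (a ∷ b ∷ c ∷ d ∷ []) p → Iso (c ∷ d ∷ e ∷ f ∷ []) p →
  let d′ = lookup (c ∷ d ∷ e ∷ f ∷ []) i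
      e′ = lookup (c ∷ d ∷ e ∷ f ∷ []) j
      c′ = lookup (a ∷ b ∷ c ∷ d′ ∷ []) j
  in Iso (a ∷ b ∷ c ∷ d′ ∷ []) p × Iso (c′ ∷ d′ ∷ e′ ∷ f ∷ []) p′

ChainsRightward : Rewiring → Vec ℕ 4 → Vec ℕ 4 → Set
ChainsRightward (i , j) p′ p = ∀ {a b c d e f} →
  Iso (a ∷ b ∷ c ∷ d ∷ []) p′ → Iso (c ∷ d ∷ e ∷ f ∷ []) p′ →
  let b′ = lookup (a ∷ b ∷ c ∷ d ∷ []) i
      c′ = lookup (a ∷ b ∷ c ∷ d ∷ []) j
      d′ = lookup (c′ ∷ d ∷ e ∷ f ∷ []) i
  in Iso (c′ ∷ d ∷ e ∷ f ∷ []) p′ × Iso (a ∷ b′ ∷ c′ ∷ d′ ∷ []) p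

-- The decidable requirements on one direction, checked by evaluation for concrete patterns. The
-- dominations concern the middle places 1 and 2; `¬overlap3` excludes occurrences at neighbouring
-- positions.
record Rewires (σ : Rewiring) (p p′ : Vec ℕ 4) : Set where
  field
    reduced    : Reduced p
    rewires    : rewire σ p ≡ p′
    dominated₁ : Dominated p (proj₁ σ) 1
    dominated₂ : Dominated p (proj₂ σ) 2
    ¬overlap3  : ¬ OverlapBy3 p

rewires? : ∀ σ p p′ → Dec (Rewires σ p p′)
rewires? σ p p′ = map′
  (λ (red , eq , dom₁ , dom₂ , ¬overlap) → record
    { reduced = red ; rewires = eq ; dominated₁ = dom₁ ; dominated₂ = dom₂ ; ¬overlap3 = ¬overlap })
  (λ r → let open Rewires r in reduced , rewires , dominated₁ , dominated₂ , ¬overlap3)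
  (List.≡-dec _≟_ _ _ ×-dec Vec.≡-dec _≟_ _ _ ×-dec dominated? p (proj₁ σ) 1 ×-dec
   dominated? p (proj₂ σ) 2 ×-dec ¬? (overlapBy? _ _ p))

-- Not symmetric in `p` and `p′`: `σ` is applied from right to left and `τ` from left to right,
-- which matters when occurrences share two entries.
record Exchange (p p′ : Vec ℕ 4) : Set where
  field
    {σ τ}     : Rewiring
    σ-rewires : Rewires σ p p′
    τ-rewires : Rewires τ p′ p
    σ-chains  : ChainsLeftward σ p p′
    τ-chains  : ChainsRightward τ p′ p

-- The bijection for a fixed set of positions.

module _ {σ : Rewiring} {p p′ : Vec ℕ 4} (σ-rewires : Rewires σ p p′) where
  open Rewires σ-rewires

  occ-rewireAfter : ∀ x (xs : Vec ℕ n) → Occ p (x ∷ xs) → Occ p′ (x ∷ rewireAfter σ x xs)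
  occ-rewireAfter a (b ∷ c ∷ d ∷ _) = subst (Iso _) rewires ∘ iso-rewire σ

  bounded-rewireAfter : ∀ {k x} (xs : Vec ℕ n) → Occ p (x ∷ xs) → Bounded k (x ∷ xs) →
                        Bounded k (x ∷ rewireAfter σ x xs)
  bounded-rewireAfter {k = k} (b ∷ c ∷ d ∷ _) iso (a≤ , b≤ , c≤ , d≤ , bd) =
      a≤
    , ≤-trans (dominated-≤ iso dominated₁ bd₄) (≤-reflexive (+-comm k 1))
    , ≤-trans (dominated-≤ iso dominated₂ bd₄) (≤-reflexive (+-comm k 2))
    , d≤ , bd
    where bd₄ = a≤ , b≤ , c≤ , d≤ , tt

  ¬occ-occ : ∀ x (xs : Vec ℕ n) → Occ p (x ∷ xs) → ¬ Occ p xs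
  ¬occ-occ a (b ∷ c ∷ d ∷ e ∷ _) iso iso′ = ¬overlap3 (overlapBy3 iso iso′)

rewireAfter² : ∀ σ τ {p} → rewire τ (rewire σ p) ≡ p → ∀ x (xs : Vec ℕ n) → Occ p (x ∷ xs) →
               rewireAfter τ x (rewireAfter σ x xs) ≡ xs
rewireAfter² σ τ eq a (b ∷ c ∷ d ∷ xs) iso = cong (λ { (_ ∷ b ∷ c ∷ _) → b ∷ c ∷ d ∷ xs }) (rewire² σ τ iso eq)

module _ {p p′ : Vec ℕ 4} (ex : Exchange p p′) where
  open Exchange ex
  open Rewires using (reduced; rewires)

  chainsLeftward : ∀ (S : Subset n) {a b c d} (xs : Vec ℕ n) →
    Iso (a ∷ b ∷ c ∷ d ∷ []) p → Occ p (c ∷ d ∷ xs) →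
    let ys = rewireAfter σ c (d ∷ xs) in
    Occ p (a ∷ b ∷ c ∷ ys) ×
    (∀ {s} → OccAll p′ (s ∷ S) ys → OccAll p′ (false ∷ true ∷ s ∷ S) (rewireAfter σ a (b ∷ c ∷ ys)))
  chainsLeftward S (e ∷ f ∷ _) iso iso′ =
    let isoₗ , isoᵣ = σ-chains iso iso′ in isoₗ , λ all → (λ ()) , (λ _ → isoᵣ) , all

  -- Only the distance to the next position of `S` matters. Distance one is impossible, distance two
  -- is covered by `σ-chains`, and from distance three on the windows share at most an entry that is
  -- never changed.
  occ-leftward : ∀ (S : Subset n) x (xs : Vec ℕ n) → Occ p (x ∷ xs) → OccAll p S xs →
                 Occ p (x ∷ rewireLeftward σ S xs)
  occ-leftward (true ∷ _) a xs@(b ∷ c ∷ d ∷ _) occ (occ₁ , _) =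
    ⊥-elim (¬occ-occ σ-rewires a xs occ (occ₁ tt))
  occ-leftward (false ∷ false ∷ s ∷ S) a (b ∷ c ∷ d ∷ xs) occ all = occ
  occ-leftward (false ∷ true ∷ s ∷ S) a (b ∷ c ∷ d ∷ xs) occ (_ , occ₂ , all) =
    proj₁ (chainsLeftward S _ occ (occ-leftward (s ∷ S) c (d ∷ xs) (occ₂ tt) all))

  occAll-leftward : (S : Subset n) (e : Vec ℕ n) → OccAll p S e → OccAll p′ S (rewireLeftward σ S e)
  occAll-leftward [] [] _ = tt
  occAll-leftward (false ∷ S) (x ∷ xs) (_ , all) = (λ ()) , occAll-leftward S xs all
  occAll-leftward (true ∷ S) (x ∷ xs) (occ , all) =
      (λ _ → occ-rewireAfter σ-rewires x _ (occ-leftward S x xs (occ tt) all))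
    , tail S xs (occ tt) all (occAll-leftward S xs all)
    where
    -- Rewiring at `x` changes just the next two entries, so only a position at distance one or two
    -- could be affected.
    tail : ∀ {n x} (S : Subset n) (xs : Vec ℕ n) → Occ p (x ∷ xs) → OccAll p S xs →
           OccAll p′ S (rewireLeftward σ S xs) → OccAll p′ S (rewireAfter σ x (rewireLeftward σ S xs))
    tail {x = a} (true ∷ _) xs@(b ∷ c ∷ d ∷ _) occ (occ₁ , _) _ =
      ⊥-elim (¬occ-occ σ-rewires a xs occ (occ₁ tt))
    tail (false ∷ false ∷ s ∷ S) (b ∷ c ∷ d ∷ xs) occ all (_ , _ , all′) = (λ ()) , (λ ()) , all′
    tail (false ∷ true ∷ s ∷ S) (b ∷ c ∷ d ∷ xs) occ (_ , occ₂ , all) (_ , _ , all′) =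
      proj₂ (chainsLeftward S _ occ (occ-leftward (s ∷ S) c (d ∷ xs) (occ₂ tt) all)) all′

  occAll-rewireAfter : ∀ (S : Subset n) x (xs : Vec ℕ n) → Occ p′ (x ∷ xs) → OccAll p′ S xs →
                       OccAll p′ S (rewireAfter τ x xs)
  occAll-rewireAfter (true ∷ _) a xs@(b ∷ c ∷ d ∷ _) occ (occ₁ , _) =
    ⊥-elim (¬occ-occ τ-rewires a xs occ (occ₁ tt))
  occAll-rewireAfter (false ∷ false ∷ S) a (b ∷ c ∷ d ∷ _) occ (_ , _ , all) = (λ ()) , (λ ()) , all
  occAll-rewireAfter (false ∷ true ∷ S) a (b ∷ c ∷ d ∷ []) occ (_ , occ₂ , all) = ⊥-elim (occ₂ tt)
  occAll-rewireAfter (false ∷ true ∷ S) a (b ∷ c ∷ d ∷ e ∷ []) occ (_ , occ₂ , all) = ⊥-elim (occ₂ tt)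
  occAll-rewireAfter (false ∷ true ∷ S) a (b ∷ c ∷ d ∷ e ∷ f ∷ _) occ (_ , occ₂ , all) =
    (λ ()) , (λ _ → proj₁ (τ-chains occ (occ₂ tt))) , all

  -- Once the window at `x` has become an occurrence of `p`, a position at distance two may still
  -- change its last entry; the second half of `τ-chains` says that it remains an occurrence.
  occ-rightward : ∀ (S : Subset n) x (xs : Vec ℕ n) → Occ p′ (x ∷ xs) → OccAll p′ S xs →
                  Occ p (x ∷ rewireRightward τ S (rewireAfter τ x xs))
  occ-rightward (true ∷ _) a xs@(b ∷ c ∷ d ∷ _) occ (occ₁ , _) =
    ⊥-elim (¬occ-occ τ-rewires a xs occ (occ₁ tt))
  occ-rightward (false ∷ false ∷ s ∷ S) a xs@(b ∷ c ∷ d ∷ _) occ all = occ-rewireAfter τ-rewires a xs occ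
  occ-rightward (false ∷ true ∷ s ∷ S) a (b ∷ c ∷ d ∷ []) occ (_ , occ₂ , _) = ⊥-elim (occ₂ tt)
  occ-rightward (false ∷ true ∷ s ∷ S) a (b ∷ c ∷ d ∷ e ∷ []) occ (_ , occ₂ , _) = ⊥-elim (occ₂ tt)
  occ-rightward (false ∷ true ∷ s ∷ S) a (b ∷ c ∷ d ∷ e ∷ f ∷ _) occ (_ , occ₂ , _) =
    proj₂ (τ-chains occ (occ₂ tt))

  occAll-rightward : (S : Subset n) (e : Vec ℕ n) → OccAll p′ S e → OccAll p S (rewireRightward τ S e)
  occAll-rightward [] [] _ = tt
  occAll-rightward (false ∷ S) (x ∷ xs) (_ , all) = (λ ()) , occAll-rightward S xs all
  occAll-rightward (true ∷ S) (x ∷ xs) (occ , all) =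
      (λ _ → occ-rightward S x xs (occ tt) all)
    , occAll-rightward S _ (occAll-rewireAfter S x xs (occ tt) all)

  -- The leftmost step is the last one made leftward and the first one undone rightward, so the
  -- steps cancel from the outside in.
  rightward∘leftward : (S : Subset n) (e : Vec ℕ n) → OccAll p S e →
                       rewireRightward τ S (rewireLeftward σ S e) ≡ e
  rightward∘leftward [] [] _ = refl
  rightward∘leftward (false ∷ S) (x ∷ xs) (_ , all) = cong (x ∷_) (rightward∘leftward S xs all)
  rightward∘leftward (true ∷ S) (x ∷ xs) (occ , all) = cong (x ∷_) (trans
    (cong (rewireRightward τ S) (rewireAfter² σ τ
      (trans (cong (rewire τ) (rewires σ-rewires)) (rewires τ-rewires)) x _
      (occ-leftward S x xs (occ tt) all)))
    (rightward∘leftward S xs all))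

  leftward∘rightward : (S : Subset n) (e : Vec ℕ n) → OccAll p′ S e →
                       rewireLeftward σ S (rewireRightward τ S e) ≡ e
  leftward∘rightward [] [] _ = refl
  leftward∘rightward (false ∷ S) (x ∷ xs) (_ , all) = cong (x ∷_) (leftward∘rightward S xs all)
  leftward∘rightward (true ∷ S) (x ∷ xs) (occ , all) = cong (x ∷_) (trans
    (cong (rewireAfter σ x) (leftward∘rightward S _ (occAll-rewireAfter S x xs (occ tt) all)))
    (rewireAfter² τ σ
      (trans (cong (rewire σ) (rewires τ-rewires)) (rewires σ-rewires)) x xs (occ tt)))

  bounded-leftward : (S : Subset n) (e : Vec ℕ n) → OccAll p S e →
                     Bounded k e → Bounded k (rewireLeftward σ S e)
  bounded-leftward [] [] _ _ = tt
  bounded-leftward (false ∷ S) (x ∷ xs) (_ , all) (x≤ , bd) = x≤ , bounded-leftward S xs all bd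
  bounded-leftward (true ∷ S) (x ∷ xs) (occ , all) (x≤ , bd) =
    bounded-rewireAfter σ-rewires _ (occ-leftward S x xs (occ tt) all) (x≤ , bounded-leftward S xs all bd)

  bounded-rightward : (S : Subset n) (e : Vec ℕ n) → OccAll p′ S e →
                      Bounded k e → Bounded k (rewireRightward τ S e)
  bounded-rightward [] [] _ _ = tt
  bounded-rightward (false ∷ S) (x ∷ xs) (_ , all) (x≤ , bd) = x≤ , bounded-rightward S xs all bd
  bounded-rightward (true ∷ S) (x ∷ xs) (occ , all) bd =
    let x≤ , bd′ = bounded-rewireAfter τ-rewires xs (occ tt) bd
    in x≤ , bounded-rightward S _ (occAll-rewireAfter S x xs (occ tt) all) bd′

  count-⊑Em : ∀ n (S : Subset n) → # (λ e → S ⊑? Em p e) ≡ # (λ e → S ⊑? Em p′ e)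
  count-⊑Em n S = count-bijection (λ e → S ⊑? Em p e) (λ e → S ⊑? Em p′ e)
    (rewireLeftward σ S) (rewireRightward τ S) (invSeqs-unique n)
    (λ {e} e∈ S⊑ → let all = to (⊑Em⇔OccAll (reduced σ-rewires) S e) S⊑ in
        ∈-invSeqs⁺ (from (isInvSeq⇔bounded _)
          (bounded-leftward S e all (to (isInvSeq⇔bounded e) (∈-invSeqs⁻ e∈))))
      , from (⊑Em⇔OccAll (reduced τ-rewires) S _) (occAll-leftward S e all)
      , rightward∘leftward S e all)
    (λ {e} e∈ S⊑ → let all = to (⊑Em⇔OccAll (reduced τ-rewires) S e) S⊑ in
        ∈-invSeqs⁺ (from (isInvSeq⇔bounded _)
          (bounded-rightward S e all (to (isInvSeq⇔bounded e) (∈-invSeqs⁻ e∈))))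
      , from (⊑Em⇔OccAll (reduced σ-rewires) S _) (occAll-rightward S e all)
      , leftward∘rightward S e all)

-- With an arbitrary property of the set of positions, one statement yields both strong equivalence
-- (its size) and super-strong equivalence (the set itself).
Equidistributed : Vec ℕ 4 → Vec ℕ 4 → Set₁
Equidistributed p p′ = ∀ n {P : Subset n → Set} (P? : Decidable P) →
  # (λ e → P? (Em p e)) ≡ # (λ e → P? (Em p′ e))

exchange⇒equidistributed : ∀ {p p′} → Exchange p p′ → Equidistributed p p′
exchange⇒equidistributed {p} {p′} ex n P? = begin
  # (P? ∘ Em p)     ≡⟨ count-map P? (Em p) (invSeqs n) ⟨
  count P? (Ems p)  ≡⟨ count-⊑⇒count (Ems p) (Ems p′) eq P? ⟩
  count P? (Ems p′) ≡⟨ count-map P? (Em p′) (invSeqs n) ⟩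
  # (P? ∘ Em p′)    ∎
  where
  open ≡-Reasoning
  Ems : Vec ℕ 4 → List (Subset n)
  Ems q = List.map (Em q) (invSeqs n)

  eq : ∀ S → count (S ⊑?_) (Ems p) ≡ count (S ⊑?_) (Ems p′)
  eq S = trans (count-map (S ⊑?_) (Em p) (invSeqs n))
    (trans (count-⊑Em ex n S) (sym (count-map (S ⊑?_) (Em p′) (invSeqs n))))

-- Exchanges for the fourteen groups.

Isolated : Rewiring → Rewiring → Vec ℕ 4 → Vec ℕ 4 → Set
Isolated σ τ p p′ = Rewires σ p p′ × Rewires τ p′ p × ¬ OverlapBy2 p × ¬ OverlapBy2 p′

isolated? : ∀ σ τ p p′ → Dec (Isolated σ τ p p′)
isolated? σ τ p p′ =
  rewires? σ p p′ ×-dec rewires? τ p′ p ×-dec ¬? (overlapBy? _ _ p) ×-dec ¬? (overlapBy? _ _ p′)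

-- Without overlaps in two entries the chain conditions are vacuous, and all that remains is
-- decidable.
isolatedExchange : ∀ σ τ {p p′} → {True (isolated? σ τ p p′)} → Exchange p p′
isolatedExchange σ τ {p} {p′} {isolated} with toWitness isolated
... | σ-rewires , τ-rewires , ¬overlap , ¬overlap′ = record
  { σ-rewires = σ-rewires
  ; τ-rewires = τ-rewires
  ; σ-chains  = λ v≅p w≅p → ⊥-elim (¬overlap (overlapBy2 v≅p w≅p))
  ; τ-chains  = λ v≅p w≅p → ⊥-elim (¬overlap′ (overlapBy2 v≅p w≅p))
  }

iso-increasing : ∀ {x y z} → x < y → y < z → (q : Vec (Fin 3) 4) →
                 Iso (Vec.map (lookup (x ∷ y ∷ z ∷ [])) q) (Vec.map toℕ q)
iso-increasing {x} {y} {z} x<y y<z q = mkIso order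
  where
  u = lookup (x ∷ y ∷ z ∷ [])

  u-mono : ∀ i j → toℕ i < toℕ j → u i < u j
  u-mono 0F 0F ()
  u-mono 0F 1F _ = x<y
  u-mono 0F 2F _ = <-trans x<y y<z
  u-mono 1F 0F ()
  u-mono 1F 1F (s≤s ())
  u-mono 1F 2F _ = y<z
  u-mono 2F 0F ()
  u-mono 2F 1F (s≤s ())
  u-mono 2F 2F (s≤s (s≤s ()))

  u-cancel : ∀ i j → u i < u j → toℕ i < toℕ j
  u-cancel i j ui<uj with <-cmp (toℕ i) (toℕ j)
  ... | tri< i<j _ _ = i<j
  ... | tri≈ _ i≡j _ = ⊥-elim (<-irrefl (cong u (toℕ-injective i≡j)) ui<uj)
  ... | tri> _ _ j<i = ⊥-elim (<-asym ui<uj (u-mono j i j<i))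

  order : OrderIso (lookup (Vec.map u q)) (lookup (Vec.map toℕ q))
  order i j rewrite Vec.lookup-map i u q | Vec.lookup-map j u q
                  | Vec.lookup-map i toℕ q | Vec.lookup-map j toℕ q =
    mk⇔ (u-cancel (lookup q i) (lookup q j)) (u-mono (lookup q i) (lookup q j))

iso-≡ : ∀ {w p : Vec ℕ 4} → Iso w p → ∀ i j → {True (lookup p i ≟ lookup p j)} →
        lookup w i ≡ lookup w j
iso-≡ w≅p i j {eq} = orderIso-≡ (orderIso w≅p) {i} {j} (toWitness eq)

iso-< : ∀ {w p : Vec ℕ 4} → Iso w p → ∀ i j → {True (lookup p i <? lookup p j)} →
        lookup w i < lookup w j
iso-< w≅p i j {lt} = from (orderIso w≅p i j) (toWitness lt)

-- Two occurrences of 0102 at distance two form `a b a d a f` with `a < b < d < f`. Rewiring the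
-- right one gives `a b a d d f`, then the left one `a b b d d f`; `τ` goes back through the same
-- words.
exchange-0102-0112 : Exchange (pat 0 1 0 2) (pat 0 1 1 2)
exchange-0102-0112 = record
  { σ-rewires = from-yes (rewires? (1F , 1F) (pat 0 1 0 2) (pat 0 1 1 2))
  ; τ-rewires = from-yes (rewires? (1F , 0F) (pat 0 1 1 2) (pat 0 1 0 2))
  ; σ-chains  = λ v≅p w≅p →
      v≅p , iso-increasing (iso-< v≅p 1F 3F) (iso-< w≅p 1F 3F) (0F ∷ 1F ∷ 1F ∷ 2F ∷ [])
  ; τ-chains  = τ-chains
  }
  where
  τ-chains : ChainsRightward (1F , 0F) (pat 0 1 1 2) (pat 0 1 0 2)
  τ-chains v≅p w≅p with refl ← iso-≡ v≅p 1F 2F | refl ← iso-≡ w≅p 1F 2F =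
      iso-increasing (<-trans (iso-< v≅p 0F 1F) (iso-< w≅p 0F 1F)) (iso-< w≅p 1F 3F) (0F ∷ 1F ∷ 1F ∷ 2F ∷ [])
    , iso-increasing (iso-< v≅p 0F 1F) (iso-< w≅p 0F 1F) (0F ∷ 1F ∷ 0F ∷ 2F ∷ [])

-- The exchange of 0102 and 0112 turned upside down: the rewirings are the same and all inequalities
-- are reversed.
exchange-2120-2110 : Exchange (pat 2 1 2 0) (pat 2 1 1 0)
exchange-2120-2110 = record
  { σ-rewires = from-yes (rewires? (1F , 1F) (pat 2 1 2 0) (pat 2 1 1 0))
  ; τ-rewires = from-yes (rewires? (1F , 0F) (pat 2 1 1 0) (pat 2 1 2 0))
  ; σ-chains  = λ v≅p w≅p →
      v≅p , iso-increasing (iso-< w≅p 3F 1F) (iso-< v≅p 3F 1F) (2F ∷ 1F ∷ 1F ∷ 0F ∷ [])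
  ; τ-chains  = τ-chains
  }
  where
  τ-chains : ChainsRightward (1F , 0F) (pat 2 1 1 0) (pat 2 1 2 0)
  τ-chains v≅p w≅p with refl ← iso-≡ v≅p 1F 2F | refl ← iso-≡ w≅p 1F 2F =
      iso-increasing (iso-< w≅p 3F 1F) (<-trans (iso-< w≅p 1F 0F) (iso-< v≅p 1F 0F)) (2F ∷ 1F ∷ 1F ∷ 0F ∷ [])
    , iso-increasing (iso-< w≅p 1F 0F) (iso-< v≅p 1F 0F) (2F ∷ 1F ∷ 2F ∷ 0F ∷ [])

-- The mirror image of passing from 0112 to 0102. Reading backwards interchanges the two directions,
-- so `σ` here mirrors `τ` there and conversely.
exchange-2110-2010 : Exchange (pat 2 1 1 0) (pat 2 0 1 0)
exchange-2110-2010 = record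
  { σ-rewires = from-yes (rewires? (3F , 2F) (pat 2 1 1 0) (pat 2 0 1 0))
  ; τ-rewires = from-yes (rewires? (2F , 2F) (pat 2 0 1 0) (pat 2 1 1 0))
  ; σ-chains  = σ-chains
  ; τ-chains  = τ-chains
  }
  where
  σ-chains : ChainsLeftward (3F , 2F) (pat 2 1 1 0) (pat 2 0 1 0)
  σ-chains v≅p w≅p with refl ← iso-≡ v≅p 1F 2F | refl ← iso-≡ w≅p 1F 2F =
      iso-increasing (<-trans (iso-< w≅p 3F 1F) (iso-< w≅p 1F 0F)) (iso-< v≅p 1F 0F) (2F ∷ 1F ∷ 1F ∷ 0F ∷ [])
    , iso-increasing (iso-< w≅p 3F 1F) (iso-< w≅p 1F 0F) (2F ∷ 0F ∷ 1F ∷ 0F ∷ [])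

  τ-chains : ChainsRightward (2F , 2F) (pat 2 0 1 0) (pat 2 1 1 0)
  τ-chains v≅p w≅p =
    w≅p , iso-increasing (iso-< w≅p 2F 0F) (iso-< v≅p 2F 0F) (2F ∷ 1F ∷ 1F ∷ 0F ∷ [])

equidistributed-refl : ∀ {p} → Equidistributed p p
equidistributed-refl n P? = refl

equidistributed-sym : ∀ {p q} → Equidistributed p q → Equidistributed q p
equidistributed-sym p≈q n P? = sym (p≈q n P?)

equidistributed-trans : ∀ {p q r} → Equidistributed p q → Equidistributed q r → Equidistributed p r
equidistributed-trans p≈q q≈r n P? = trans (p≈q n P?) (q≈r n P?)

EquidistributedGroup : List (Vec ℕ 4) → Set₁
EquidistributedGroup g = ∀ {p p′} → p ∈ g → p′ ∈ g → Equidistributed p p′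

hub : ∀ q {g} → All (Equidistributed q) g → EquidistributedGroup g
hub q q≈g p∈ p′∈ = equidistributed-trans (equidistributed-sym (All.lookup q≈g p∈)) (All.lookup q≈g p′∈)

isolated : ∀ σ τ {p p′} → {True (isolated? σ τ p p′)} → Equidistributed p p′
isolated σ τ {p} {p′} {cond} = exchange⇒equidistributed (isolatedExchange σ τ {p} {p′} {cond})

groups-equidistributed : All EquidistributedGroup groups
groups-equidistributed =
    hub (pat 0 1 0 2) (equidistributed-refl ∷ exchange⇒equidistributed exchange-0102-0112 ∷ [])
  ∷ hub (pat 0 0 2 1) (equidistributed-refl ∷ isolated (3F , 2F) (0F , 2F) ∷ [])
  ∷ hub (pat 1 0 0 2) (equidistributed-refl ∷ isolated (1F , 0F) (1F , 1F) ∷ isolated (0F , 1F) (2F , 2F) ∷ [])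
  ∷ hub (pat 0 1 0 0) (equidistributed-refl ∷ isolated (1F , 1F) (1F , 0F) ∷ [])
  -- `(2F , 1F)` interchanges the two middle places and is its own inverse.
  ∷ hub (pat 2 0 1 3) (equidistributed-refl ∷ isolated (2F , 1F) (2F , 1F) ∷ [])
  ∷ hub (pat 1 2 0 0) (equidistributed-refl ∷ isolated (1F , 0F) (1F , 3F) ∷ isolated (1F , 1F) (1F , 3F) ∷ [])
  ∷ hub (pat 0 2 1 1) (equidistributed-refl ∷ isolated (1F , 1F) (1F , 3F) ∷ [])
  ∷ hub (pat 1 0 0 0) (equidistributed-refl ∷ isolated (0F , 0F) (3F , 3F) ∷ [])
  ∷ hub (pat 1 0 0 1) (equidistributed-refl ∷ isolated (1F , 0F) (1F , 1F) ∷ isolated (0F , 1F) (2F , 2F) ∷ [])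
  ∷ hub (pat 2 1 0 0) (equidistributed-refl ∷ isolated (0F , 1F) (2F , 3F) ∷ [])
  ∷ hub (pat 2 0 0 1) (equidistributed-refl ∷ isolated (1F , 3F) (1F , 1F) ∷ isolated (3F , 1F) (2F , 2F)
                        ∷ isolated (0F , 1F) (2F , 2F) ∷ [])
  ∷ hub (pat 2 0 1 2) (equidistributed-refl ∷ isolated (2F , 1F) (2F , 1F) ∷ [])
  -- 2110 is the hub because both of the exchanges for this group involve it.
  ∷ hub (pat 2 1 1 0) (exchange⇒equidistributed exchange-2110-2010 ∷ equidistributed-refl
                        ∷ equidistributed-sym (exchange⇒equidistributed exchange-2120-2110) ∷ [])
  ∷ hub (pat 3 0 1 2) (equidistributed-refl ∷ isolated (2F , 1F) (2F , 1F) ∷ [])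
  ∷ []

-- Computing the numbers of avoiders.

SameOrder : ℕ → ℕ → ℕ → ℕ → Set
SameOrder x y u v = (x < y ⇔ u < v) × (y < x ⇔ v < u)

sameOrder? : ∀ x y u v → Dec (SameOrder x y u v)
sameOrder? x y u v = <-⇔-<? x y u v ×-dec <-⇔-<? y x v u

head-sameOrder? : ∀ x u (w p : Vec ℕ n) → Dec (∀ i → SameOrder x (lookup w i) u (lookup p i))
head-sameOrder? x u [] [] = yes λ ()
head-sameOrder? x u (y ∷ w) (v ∷ p) = map′
  (λ { (eq , eqs) zero → eq ; (eq , eqs) (suc i) → eqs i }) (λ eqs → eqs zero , eqs ∘ suc)
  (sameOrder? x y u v ×-dec head-sameOrder? x u w p)

iso? : (w p : Vec ℕ n) → Dec (Iso w p)
iso? [] [] = yes (mkIso λ ())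
iso? (x ∷ w) (u ∷ p) = map′
  (λ (eqs , w≅p) → mkIso λ
    { zero zero → mk⇔ (⊥-elim ∘ <-irrefl refl) (⊥-elim ∘ <-irrefl refl)
    ; zero (suc j) → proj₁ (eqs j)
    ; (suc i) zero → proj₂ (eqs i)
    ; (suc i) (suc j) → orderIso w≅p i j })
  (λ xw≅up → (λ i → orderIso xw≅up zero (suc i) , orderIso xw≅up (suc i) zero)
           , mkIso λ i j → orderIso xw≅up (suc i) (suc j))
  (head-sameOrder? x u w p ×-dec iso? w p)

-- Built from the front, where `Occ` looks, whereas `invSeqs` appends at the end.
boundedSeqs : ∀ k n → List (Vec ℕ n)
boundedSeqs k zero    = [] ∷ []
boundedSeqs k (suc n) = cartesianProductWith _∷_ (upTo (suc k)) (boundedSeqs (suc k) n)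

boundedSeqs-unique : ∀ k n → Unique (boundedSeqs k n)
boundedSeqs-unique k zero    = [] ∷ []
boundedSeqs-unique k (suc n) =
  Unique.cartesianProductWith⁺ _∷_ Vec.∷-injective (Unique.upTo⁺ (suc k)) (boundedSeqs-unique (suc k) n)

∈-boundedSeqs : ∀ k {e : Vec ℕ n} → Bounded k e ⇔ e ∈ boundedSeqs k n
∈-boundedSeqs k {[]} = mk⇔ (λ _ → here refl) (λ _ → tt)
∈-boundedSeqs k {x ∷ xs} = mk⇔
  (λ (x≤k , bd) → ∈-cartesianProductWith⁺ _∷_ (∈-upTo⁺ (s≤s x≤k)) (to (∈-boundedSeqs (suc k)) bd))
  ⇐
  where
  ⇐ : x ∷ xs ∈ boundedSeqs k _ → Bounded k (x ∷ xs)
  ⇐ e∈ with ∈-cartesianProductWith⁻ _∷_ (upTo (suc k)) (boundedSeqs (suc k) _) e∈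
  ... | _ , _ , x∈ , xs∈ , refl = ≤-pred (∈-upTo⁻ x∈) , from (∈-boundedSeqs (suc k)) xs∈

invSeqs↭boundedSeqs : ∀ n → invSeqs n ↭ boundedSeqs 0 n
invSeqs↭boundedSeqs n = unique-⇔⇒↭ (invSeqs-unique n) (boundedSeqs-unique 0 n) (λ {e} → mk⇔
  (to (∈-boundedSeqs 0) ∘ to (isInvSeq⇔bounded e) ∘ ∈-invSeqs⁻)
  (∈-invSeqs⁺ ∘ from (isInvSeq⇔bounded e) ∘ from (∈-boundedSeqs 0)))

count-cartesianProductWith : ∀ {A B C : Set} (f : A → B → C) {P : C → Set} (P? : Decidable P) xs ys →
  count P? (cartesianProductWith f xs ys) ≡ sum (List.map (λ x → count (P? ∘ f x) ys) xs)
count-cartesianProductWith f P? [] ys = refl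
count-cartesianProductWith f P? (x ∷ xs) ys = begin
  length (filter P? (List.map (f x) ys ++ zs))
    ≡⟨ cong length (List.filter-++ P? (List.map (f x) ys) zs) ⟩
  length (filter P? (List.map (f x) ys) ++ filter P? zs)
    ≡⟨ List.length-++ (filter P? (List.map (f x) ys)) ⟩
  count P? (List.map (f x) ys) + count P? zs
    ≡⟨ cong₂ _+_ (count-map P? (f x) ys) (count-cartesianProductWith f P? xs ys) ⟩
  count (P? ∘ f x) ys + sum (List.map (λ x → count (P? ∘ f x) ys) xs) ∎
  where
  open ≡-Reasoning
  zs = cartesianProductWith f xs ys

zipWith-mapʳ : ∀ {A B C : Set} (f : A → B → C) (g : A → B) xs →
  List.zipWith f xs (List.map g xs) ≡ List.map (λ x → f x (g x)) xs
zipWith-mapʳ f g [] = refl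
zipWith-mapʳ f g (x ∷ xs) = cong (f x (g x) ∷_) (zipWith-mapʳ f g xs)

module _ (p : Vec ℕ 4) where
  unlessOcc : ℕ → ℕ → ℕ → ℕ → ℕ → ℕ
  unlessOcc a b c d x = if does (iso? (a ∷ b ∷ c ∷ d ∷ []) p) then 0 else x

  -- The number of ways to extend a word ending in a b c by m entries, the first
  -- one at most 2 + k, without a further occurrence of p.
  extensions : (m k a b c : ℕ) → ℕ
  extensions zero    k a b c = 1
  extensions (suc m) k a b c =
    sum (List.map (λ d → unlessOcc a b c d (extensions m (suc k) b c d)) (upTo (3 + k)))

  -- The entries satisfy `a < k`, `b < 1 + k`, `c < 2 + k`, `d < 3 + k`. The table `t` for the next
  -- place is indexed by `b`, `c`, `d`, so it is shared by all `a` and its rows are summed over `d`.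
  nextTable : ℕ → List (List (List ℕ)) → List (List (List ℕ))
  nextTable k t = List.map (λ a → List.zipWith (λ b rows → List.zipWith (λ c row →
    sum (List.zipWith (unlessOcc a b c) (upTo (3 + k)) row)) (upTo (2 + k)) rows) (upTo (1 + k)) t) (upTo k)

  tabulate₃ : ℕ → (ℕ → ℕ → ℕ → ℕ) → List (List (List ℕ))
  tabulate₃ k f =
    List.map (λ a → List.map (λ b → List.map (f a b) (upTo (2 + k))) (upTo (1 + k))) (upTo k)

  -- The values of extensions m k, computed without repeating recursive calls; the
  -- previous table is an argument of nextTable so that it is evaluated only once.
  table : (m k : ℕ) → List (List (List ℕ))
  table zero    k = tabulate₃ k λ _ _ _ → 1
  table (suc m) k = nextTable k (table m (suc k))

  table-extensions : ∀ m k → table m k ≡ tabulate₃ k (extensions m k)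
  table-extensions zero    k = refl
  table-extensions (suc m) k rewrite table-extensions m (suc k) =
    List.map-cong (λ a → trans (zipWith-mapʳ _ _ (upTo (1 + k)))
      (List.map-cong (λ b → trans (zipWith-mapʳ _ _ (upTo (2 + k)))
        (List.map-cong (λ c → cong sum (zipWith-mapʳ (unlessOcc a b c) _ (upTo (3 + k)))) (upTo (2 + k))))
        (upTo (1 + k)))) (upTo k)

  -- At `k = 1` the table runs over the first three entries of an inversion sequence, so the length
  -- counted is `3 + m`.
  avoiders : ℕ → ℕ
  avoiders m = sum (List.map (sum ∘ List.map sum) (table m 1))

  module _ (p-reduced : Reduced p) where
    avoids-∷ : ∀ x (e : Vec ℕ n) → Avoids p (x ∷ e) ⇔ (¬ Occ p (x ∷ e) × Avoids p e)
    avoids-∷ x e = mk⇔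
      (λ av → (λ occ → absurd (from (occursAt-zero p-reduced (x ∷ e)) occ) (Vec.∷-injectiveˡ av))
            , Vec.∷-injectiveʳ av)
      (λ (¬occ , av) → cong₂ _∷_ (dec-false (occursAt? p (x ∷ e) zero)
                                   (¬occ ∘ to (occursAt-zero p-reduced (x ∷ e)))) av)
      where
      absurd : OccursAt p (x ∷ e) zero → ¬ does (occursAt? p (x ∷ e) zero) ≡ false
      absurd at eq with trans (sym eq) (dec-true (occursAt? p (x ∷ e) zero) at)
      ... | ()

    count-extensions : ∀ m k a b c →
      count (λ e → avoids? p (a ∷ b ∷ c ∷ e)) (boundedSeqs (2 + k) m) ≡ extensions m k a b c
    count-extensions zero k a b c = cong length
      (List.filter-accept (λ e → avoids? p (a ∷ b ∷ c ∷ e))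
        (from (avoids-∷ a (b ∷ c ∷ [])) ((λ ()) ,
          from (avoids-∷ b (c ∷ [])) ((λ ()) , from (avoids-∷ c []) ((λ ()) , refl)))))
    count-extensions (suc m) k a b c = trans
      (count-cartesianProductWith _∷_ (λ e → avoids? p (a ∷ b ∷ c ∷ e)) (upTo (3 + k)) (boundedSeqs (3 + k) m))
      (cong sum (List.map-cong byNext (upTo (3 + k))))
      where
      byNext : ∀ d → count (λ e → avoids? p (a ∷ b ∷ c ∷ d ∷ e)) (boundedSeqs (3 + k) m) ≡
                     unlessOcc a b c d (extensions m (suc k) b c d)
      byNext d with iso? (a ∷ b ∷ c ∷ d ∷ []) p
      ... | yes occ = cong length (List.filter-none (λ e → avoids? p (a ∷ b ∷ c ∷ d ∷ e))
        (All.universal (λ e av → proj₁ (to (avoids-∷ a (b ∷ c ∷ d ∷ e)) av) occ)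
          (boundedSeqs (3 + k) m)))
      ... | no ¬occ = trans
        (count-≐ (λ e → avoids? p (a ∷ b ∷ c ∷ d ∷ e)) (λ e → avoids? p (b ∷ c ∷ d ∷ e))
          (λ e → mk⇔ (λ av → proj₂ (to (avoids-∷ a (b ∷ c ∷ d ∷ e)) av))
                     (λ av → from (avoids-∷ a (b ∷ c ∷ d ∷ e)) (¬occ , av)))
          (boundedSeqs (3 + k) m))
        (count-extensions m (suc k) b c d)

    #avoids≡avoiders : ∀ m → # {3 + m} (avoids? p) ≡ avoiders m
    #avoids≡avoiders m = begin
      # {3 + m} (avoids? p)
        ≡⟨ ↭-length (filter-↭ (avoids? p) (invSeqs↭boundedSeqs (3 + m))) ⟩
      count (avoids? p) (boundedSeqs 0 (3 + m))
        ≡⟨ count-cartesianProductWith _∷_ (avoids? p) (upTo 1) (boundedSeqs 1 (2 + m)) ⟩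
      sum (List.map (λ a → count (avoids? p ∘ (a ∷_)) (boundedSeqs 1 (2 + m))) (upTo 1))
        ≡⟨ cong sum (List.map-cong (λ a → trans
             (count-cartesianProductWith _∷_ (avoids? p ∘ (a ∷_)) (upTo 2) (boundedSeqs 2 (1 + m)))
             (cong sum (List.map-cong (λ b → trans
               (count-cartesianProductWith _∷_ (λ e → avoids? p (a ∷ b ∷ e)) (upTo 3) (boundedSeqs 3 m))
               (cong sum (List.map-cong (λ c → count-extensions m 1 a b c) (upTo 3)))) (upTo 2)))) (upTo 1)) ⟩
      sum (List.map (λ a → sum (List.map (λ b → sum (List.map (extensions m 1 a b) (upTo 3))) (upTo 2))) (upTo 1))
        ≡⟨⟩
      sum (List.map (sum ∘ List.map sum) (tabulate₃ 1 (extensions m 1)))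
        ≡⟨ cong (sum ∘ List.map (sum ∘ List.map sum)) (table-extensions m 1) ⟨
      avoiders m ∎
      where open ≡-Reasoning

-- Separating the patterns by enumeration.

Gapless : Vec ℕ 4 → Set
Gapless p = ∀ i → pred (lookup p i) Vec.∈ p

gapless? : Decidable Gapless
gapless? p = all? λ i → VecAny.any? (pred (lookup p i) ≟_) p

words : ∀ n → List (Vec ℕ n)
words zero    = [] ∷ []
words (suc n) = cartesianProductWith _∷_ (upTo 4) (words n)

patterns : List (Vec ℕ 4)
patterns = filter gapless? (words 4)

_≟ᵛ_ : (p q : Vec ℕ 4) → Dec (p ≡ q)
_≟ᵛ_ = Vec.≡-dec _≟_

sameGroup? : ∀ p q → Dec (SameGroup p q)
sameGroup? p q = Any.any? (λ g → member? _≟ᵛ_ p g ×-dec member? _≟ᵛ_ q g) groups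

∈-words : (w : Vec ℕ n) → (∀ i → lookup w i < 4) → w ∈ words n
∈-words []      _  = here refl
∈-words (x ∷ w) <4 = ∈-cartesianProductWith⁺ _∷_ (∈-upTo⁺ (<4 zero)) (∈-words w (<4 ∘ suc))

-- `Gapless` ranges over places instead of all values, which makes it decidable; an entry 0 is
-- harmless, being its own `pred`.
isPattern⇒∈patterns : ∀ {p} → IsPattern p → p ∈ patterns
isPattern⇒∈patterns {p} (<4 , closed) = ∈-filter⁺ gapless? (∈-words p <4) gapless
  where
  gapless : Gapless p
  gapless i with lookup p i | Vec.∈-lookup i p
  ... | zero  | 0∈ = 0∈
  ... | suc j | j∈ = closed j j∈

-- Checking the argument `refl` evaluates only the Boolean part of a large decision.
witness : {A : Set} (a? : Dec A) → does a? ≡ true → A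
witness (yes a) _ = a

patterns-reduced : All Reduced patterns
patterns-reduced = witness (All.all? (λ p → List.≡-dec _≟_ (reduction (toList p)) (toList p)) patterns) refl

-- The numbers are stored beside the patterns, so that comparing pairs need not recompute them.
Separated : List (Vec ℕ 4 × ℕ) → Set
Separated ps = All (λ (p , k) → All (λ (q , l) → k ≡ l → p ≡ q ⊎ SameGroup p q) ps) ps

separated? : Decidable Separated
separated? ps = All.all? (λ (p , k) →
  All.all? (λ (q , l) → k ≟ l →-dec (p ≟ᵛ q ⊎-dec sameGroup? p q)) ps) ps

withAvoiders : Vec ℕ 4 → Vec ℕ 4 × ℕ
withAvoiders p = p , avoiders p 8

-- No length below 11 = 3 + 8 separates all the classes.
patterns-separated : Separated (List.map withAvoiders patterns)
patterns-separated = witness (separated? (List.map withAvoiders patterns)) refl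

wilf⇒avoiders≡ : ∀ {p p′} → p ∈ patterns → p′ ∈ patterns → Wilf p p′ →
                 ∀ m → avoiders p m ≡ avoiders p′ m
wilf⇒avoiders≡ {p} {p′} p∈ p′∈ wilf m = begin
  avoiders p m           ≡⟨ #avoids≡avoiders p (All.lookup patterns-reduced p∈) m ⟨
  # {3 + m} (avoids? p)  ≡⟨ wilf (3 + m) ⟩
  # {3 + m} (avoids? p′) ≡⟨ #avoids≡avoiders p′ (All.lookup patterns-reduced p′∈) m ⟩
  avoiders p′ m          ∎
  where open ≡-Reasoning

wilf⇒sameGroup : ∀ {p p′} → IsPattern p → IsPattern p′ → p ≢ p′ → Wilf p p′ → SameGroup p p′
wilf⇒sameGroup p-pat p′-pat p≢p′ wilf =
  [ ⊥-elim ∘ p≢p′ , id ]′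
    (All.lookup (All.lookup patterns-separated (∈-map⁺ withAvoiders p∈)) (∈-map⁺ withAvoiders p′∈)
      (wilf⇒avoiders≡ p∈ p′∈ wilf 8))
  where
  p∈  = isPattern⇒∈patterns p-pat
  p′∈ = isPattern⇒∈patterns p′-pat

-- The three equivalences.

sameGroup⇒equidistributed : ∀ {p p′} → SameGroup p p′ → Equidistributed p p′
sameGroup⇒equidistributed = go groups-equidistributed
  where
  go : ∀ {gs p p′} → All EquidistributedGroup gs → Any (λ g → p ∈ g × p′ ∈ g) gs → Equidistributed p p′
  go (equidistributed ∷ _) (here (p∈ , p′∈)) = equidistributed p∈ p′∈
  go (_ ∷ rest)            (there group)     = go rest group

equidistributed⇒superStrong : ∀ {p p′} → Equidistributed p p′ → SuperStrongWilf p p′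
equidistributed⇒superStrong p≈p′ n S = p≈p′ n (_≟ˢ S)

equidistributed⇒strong : ∀ {p p′} → Equidistributed p p′ → StrongWilf p p′
equidistributed⇒strong p≈p′ n m = p≈p′ n (λ S → ∣ S ∣ ≟ m)

-- Avoidance is by definition the case of the empty set of positions.
superStrong⇒wilf : ∀ {p p′ : Vec ℕ 4} → SuperStrongWilf p p′ → Wilf p p′
superStrong⇒wilf superStrong n = superStrong n Subset.⊥

∣S∣≡0⇔S≡⊥ : (S : Subset n) → ∣ S ∣ ≡ 0 ⇔ S ≡ Subset.⊥
∣S∣≡0⇔S≡⊥ []          = mk⇔ (λ _ → refl) (λ _ → refl)
∣S∣≡0⇔S≡⊥ (true  ∷ S) = mk⇔ (λ ()) (λ ())
∣S∣≡0⇔S≡⊥ (false ∷ S) = mk⇔ (cong (false ∷_) ∘ to (∣S∣≡0⇔S≡⊥ S)) (from (∣S∣≡0⇔S≡⊥ S) ∘ Vec.∷-injectiveʳ)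

strong⇒wilf : ∀ {p p′ : Vec ℕ 4} → StrongWilf p p′ → Wilf p p′
strong⇒wilf {p} {p′} strong n = begin
  # {n} (avoids? p)             ≡⟨ noOccurrence p ⟨
  # {n} (λ e → ∣ Em p e ∣ ≟ 0)  ≡⟨ strong n 0 ⟩
  # {n} (λ e → ∣ Em p′ e ∣ ≟ 0) ≡⟨ noOccurrence p′ ⟩
  # {n} (avoids? p′)            ∎
  where
  open ≡-Reasoning
  noOccurrence : ∀ q → # {n} (λ e → ∣ Em q e ∣ ≟ 0) ≡ # {n} (avoids? q)
  noOccurrence q = count-≐ (λ e → ∣ Em q e ∣ ≟ 0) (avoids? q) (λ e → ∣S∣≡0⇔S≡⊥ (Em q e)) (invSeqs n)

theorem1 : All (λ g → ∀ {p p′} → p ∈ g → p′ ∈ g → SuperStrongWilf p p′) groups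
    × (∀ (p p′ : Vec ℕ 4) → IsPattern p → IsPattern p′ → p ≢ p′ →
    Wilf p p′ → SameGroup p p′)
    × (∀ (p p′ : Vec ℕ 4) → IsPattern p → IsPattern p′ → p ≢ p′ →
    (Wilf p p′ ⇔ SameGroup p p′)
    × (StrongWilf p p′ ⇔ SameGroup p p′)
    × (SuperStrongWilf p p′ ⇔ SameGroup p p′))
theorem1 =
    All.map (λ eq {p} {p′} p∈ p′∈ → equidistributed⇒superStrong (eq p∈ p′∈)) groups-equidistributed
  , (λ _ _ → wilf⇒sameGroup)
  , λ p p′ p-pat p′-pat p≢p′ →
      let wilf⇒ = wilf⇒sameGroup p-pat p′-pat p≢p′ in
        mk⇔ wilf⇒ (superStrong⇒wilf ∘ equidistributed⇒superStrong ∘ sameGroup⇒equidistributed)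
      , mk⇔ (wilf⇒ ∘ strong⇒wilf) (equidistributed⇒strong ∘ sameGroup⇒equidistributed)
      , mk⇔ (wilf⇒ ∘ superStrong⇒wilf) (equidistributed⇒superStrong ∘ sameGroup⇒equidistributed)
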